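{- Let $(L,\vee,\wedge,{}',0,1)$ be a non-trivial complete orthomodular lattice, let $(T,R)$ be a time frame, let $P,F,H,G\colon L^T\to L^T$ denote the tense operators induced by $(T,R)$, and let $A\in\{P,F,H,G\}$. Then the following two assertions are equivalent: (i) $A(x)\odot A(y)\leq A(x\odot y)$ for all $x,y\in L^T$; (ii) $A(x\rightarrow y)\leq A(x)\rightarrow A(y)$ for all $x,y\in L^T$.
   Context: An orthomodular lattice is an algebra $(L,\vee,\wedge,{}',0,1)$ such that $(L,\vee,\wedge,0,1)$ is a bounded lattice, $'$ is an antitone involution ($x\leq y$ implies $y'\leq x'$, and $x''=x$), $x\vee x'=1$ and $x\wedge x'=0$ for all $x\in L$, and the orthomodular law holds: if $x\leq y$ then $y=x\vee(y\wedge x')$. It is complete if its underlying lattice is complete; non-trivial means that $L$ has more than one element. On $L$ one defines $x\odot y:=(x\vee y')\wedge y$ and $x\rightarrow y:=(y\wedge x)\vee x'$. A time frame is a pair $(T,R)$ consisting of a non-empty set $T$ and a non-empty binary relation $R\subseteq T\times T$; $s\mathrel R t$ means $(s,t)\in R$. $L^T$ is the set of all functions $T\to L$, with order and operations (including $\odot$ and $\rightarrow$) defined pointwise. The tense operators $P,F,H,G\colon L^T\to L^T$ induced by $(T,R)$ are defined, for $q\in L^T$ and $s\in T$, by $P(q)(s):=\bigvee\{q(t)\mid t\mathrel R s\}$, $F(q)(s):=\bigvee\{q(t)\mid s\mathrel R t\}$, $H(q)(s):=\bigwedge\{q(t)\mid t\mathrel R s\}$, $G(q)(s):=\bigwedge\{q(t)\mid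 s\mathrel R t\}$, where the join of the empty set is $0$ and the meet of the empty set is $1$. -}

module Defs where

open import Algebra.Core using (Op₁; Op₂)
open import Algebra.Definitions using (Involutive)
open import Data.Product using (∃; ∃₂; _×_)
open import Level using (Level; suc; _⊔_)
open import Relation.Binary.Core using (Rel)
open import Relation.Binary.Definitions using (Antitonic₁)
open import Relation.Binary.Lattice.Bundles using (BoundedLattice)
open import Relation.Nullary.Negation using (¬_)
open import Relation.Unary using (Pred; _∈_)

-- The constants 0 and 1 are ⊥ and ⊤.  Congruence of _′ for _≈_ is not a field:
-- it follows from antitonicity and antisymmetry.
record OrthomodularLattice (c ℓ₁ ℓ₂ : Level) : Set (suc (c ⊔ ℓ₁ ⊔ ℓ₂)) where
  field
    boundedLattice : BoundedLattice c ℓ₁ ℓ₂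

  open BoundedLattice boundedLattice public

  infix 8 _′
  field
    _′           : Op₁ Carrier
    ′-antitone   : Antitonic₁ _≤_ _≤_ _′
    ′-involutive : Involutive _≈_ _′
    ∨-complement : ∀ x → x ∨ x ′ ≈ ⊤
    ∧-complement : ∀ x → x ∧ x ′ ≈ ⊥
    orthomodular : ∀ x y → x ≤ y → y ≈ x ∨ (y ∧ x ′)

  infixr 7 _⊙_
  infixr 5 _⇒_

  _⊙_ : Op₂ Carrier
  x ⊙ y = (x ∨ y ′) ∧ y

  _⇒_ : Op₂ Carrier
  x ⇒ y = (y ∧ x) ∨ x ′

  NonTrivial : Set (c ⊔ ℓ₁)
  NonTrivial = ∃₂ λ x y → ¬ (x ≈ y)

  IsSupremum : ∀ {p} → Pred Carrier p → Carrier → Set (c ⊔ ℓ₂ ⊔ p)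
  IsSupremum S a = (∀ x → x ∈ S → x ≤ a) × (∀ b → (∀ x → x ∈ S → x ≤ b) → a ≤ b)

  IsInfimum : ∀ {p} → Pred Carrier p → Carrier → Set (c ⊔ ℓ₂ ⊔ p)
  IsInfimum S a = (∀ x → x ∈ S → a ≤ x) × (∀ b → (∀ x → x ∈ S → b ≤ x) → b ≤ a)

-- Subsets of the carrier are predicates, so completeness is relative to the
-- universe level p in which those predicates take their values.
record CompleteOrthomodularLattice (c ℓ₁ ℓ₂ p : Level)
       : Set (suc (c ⊔ ℓ₁ ⊔ ℓ₂ ⊔ p)) where
  field
    orthomodularLattice : OrthomodularLattice c ℓ₁ ℓ₂

  open OrthomodularLattice orthomodularLattice public

  field
    ⋁            : Pred Carrier p → Carrier
    ⋁-isSupremum : ∀ S → IsSupremum S (⋁ S)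
    ⋀            : Pred Carrier p → Carrier
    ⋀-isInfimum  : ∀ S → IsInfimum S (⋀ S)

record TimeFrame (t r : Level) : Set (suc (t ⊔ r)) where
  field
    T          : Set t
    R          : Rel T r
    T-nonEmpty : T
    R-nonEmpty : ∃₂ R

-- The level ℓ₁ ⊔ t ⊔ r is that of the subsets { q(u) | u R s } of the carrier,
-- which are closed under the lattice's equality _≈_.
module Tense {c ℓ₁ ℓ₂ t r : Level}
             (L : CompleteOrthomodularLattice c ℓ₁ ℓ₂ (ℓ₁ ⊔ t ⊔ r))
             (frame : TimeFrame t r) where

  open CompleteOrthomodularLattice L
  open TimeFrame frame

  Lᵀ : Set (c ⊔ t)
  Lᵀ = T → Carrier

  infix  4 _≤ᵀ_
  infixr 7 _⊙ᵀ_
  infixr 5 _⇒ᵀ_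

  _≤ᵀ_ : Rel Lᵀ (ℓ₂ ⊔ t)
  x ≤ᵀ y = ∀ s → x s ≤ y s

  _⊙ᵀ_ : Op₂ Lᵀ
  (x ⊙ᵀ y) s = x s ⊙ y s

  _⇒ᵀ_ : Op₂ Lᵀ
  (x ⇒ᵀ y) s = x s ⇒ y s

  -- { q(u) | u R s }
  pastValues : Lᵀ → T → Pred Carrier (ℓ₁ ⊔ t ⊔ r)
  pastValues q s a = ∃ λ u → R u s × a ≈ q u

  -- { q(u) | s R u }
  futureValues : Lᵀ → T → Pred Carrier (ℓ₁ ⊔ t ⊔ r)
  futureValues q s a = ∃ λ u → R s u × a ≈ q u

  P F H G : Op₁ Lᵀ
  P q s = ⋁ (pastValues q s)
  F q s = ⋁ (futureValues q s)
  H q s = ⋀ (pastValues q s)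
  G q s = ⋀ (futureValues q s)

{-# OPTIONS --safe #-}

-- Sasaki multiplication is residuated: x ⊙ y ≤ z iff x ≤ y ⇒ z.  Hence for a
-- monotone operator A both conditions are obtained from the unit
-- x ≤ y ⇒ (x ⊙ y) and the counit (x ⇒ y) ⊙ x ≤ y of this adjunction.
module Submission where

open import Defs
open import Data.List.Base using ([]; _∷_)
open import Data.List.Membership.Propositional using (_∈_)
open import Data.List.Relation.Unary.Any using (here; there)
open import Data.Product using (_,_; proj₁; proj₂)
open import Function.Bundles using (_⇔_; mk⇔)
open import Level using (Level; _⊔_)
open import Relation.Binary.PropositionalEquality using (refl)

module Residuation {c ℓ₁ ℓ₂ : Level} (L : OrthomodularLattice c ℓ₁ ℓ₂) where

  open OrthomodularLattice L renaming (refl to ≤-refl)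

  x≤x′′ : ∀ x → x ≤ x ′ ′
  x≤x′′ x = reflexive (Eq.sym (′-involutive x))

  x′′≤x : ∀ x → x ′ ′ ≤ x
  x′′≤x x = reflexive (′-involutive x)

  ′-cancel-≤ : ∀ {x y} → x ′ ≤ y ′ → y ≤ x
  ′-cancel-≤ {x} {y} x′≤y′ = trans (x≤x′′ y) (trans (′-antitone x′≤y′) (x′′≤x x))

  -- Half of a De Morgan law, from antitonicity and double negation alone.
  x∨y≤[x′∧y′]′ : ∀ x y → x ∨ y ≤ (x ′ ∧ y ′) ′
  x∨y≤[x′∧y′]′ x y = ∨-least
    (trans (x≤x′′ x) (′-antitone (x∧y≤x (x ′) (y ′))))
    (trans (x≤x′′ y) (′-antitone (x∧y≤y (x ′) (y ′))))

  -- The dual of the orthomodular law, obtained by applying that law to y ′ ≤ x ′.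
  x≤y⇒x⊙y≤x : ∀ {x y} → x ≤ y → x ⊙ y ≤ x
  x≤y⇒x⊙y≤x {x} {y} x≤y = ′-cancel-≤
    (trans (reflexive (orthomodular (y ′) (x ′) (′-antitone x≤y)))
      (∨-least
        (′-antitone (x∧y≤y (x ∨ y ′) y))
        (trans (x≤x′′ (x ′ ∧ y ′ ′))
          (′-antitone (trans (x∧y≤x (x ∨ y ′) y) (x∨y≤[x′∧y′]′ x (y ′)))))))

  -- The orthomodular law at `y ′ ≤ x ∨ y ′` splits `x ∨ y ′` into `y ′` and a part that is `x ⊙ y`
  -- up to double negation. That part lies below both `z` and `y`.
  ⊙-residualʳ : ∀ {x y z} → x ⊙ y ≤ z → x ≤ y ⇒ z
  ⊙-residualʳ {x} {y} {z} x⊙y≤z =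
    trans (x≤x∨y x (y ′))
      (trans (reflexive (orthomodular (y ′) (x ∨ y ′) (y≤x∨y x (y ′))))
        (∨-least (y≤x∨y (z ∧ y) (y ′))
          (trans (∧-greatest (trans [x∨y′]∧y′′≤x⊙y x⊙y≤z)
                             (trans [x∨y′]∧y′′≤x⊙y (x∧y≤y (x ∨ y ′) y)))
                 (x≤x∨y (z ∧ y) (y ′)))))
    where
    [x∨y′]∧y′′≤x⊙y : (x ∨ y ′) ∧ y ′ ′ ≤ x ⊙ y
    [x∨y′]∧y′′≤x⊙y = ∧-greatest (x∧y≤x (x ∨ y ′) (y ′ ′))
                                (trans (x∧y≤y (x ∨ y ′) (y ′ ′)) (x′′≤x y))

  -- Both `x` and `y ′` lie below `y ⇒ z`, so `x ⊙ y ≤ (y ⇒ z) ∧ y`. The right side is by definition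
  -- `(z ∧ y) ⊙ y`, to which the dual law applies because `z ∧ y ≤ y`.
  ⊙-residualˡ : ∀ {x y z} → x ≤ y ⇒ z → x ⊙ y ≤ z
  ⊙-residualˡ {x} {y} {z} x≤y⇒z =
    trans (∧-greatest
            (trans (x∧y≤x (x ∨ y ′) y) (∨-least x≤y⇒z (y≤x∨y (z ∧ y) (y ′))))
            (x∧y≤y (x ∨ y ′) y))
      (trans (x≤y⇒x⊙y≤x (x∧y≤y z y)) (x∧y≤x z y))

  x≤y⇒[x⊙y] : ∀ x y → x ≤ y ⇒ (x ⊙ y)
  x≤y⇒[x⊙y] x y = ⊙-residualʳ ≤-refl

  [x⇒y]⊙x≤y : ∀ x y → (x ⇒ y) ⊙ x ≤ y
  [x⇒y]⊙x≤y x y = ⊙-residualˡ ≤-refl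

module TenseProperties {c ℓ₁ ℓ₂ t r : Level}
         (L : CompleteOrthomodularLattice c ℓ₁ ℓ₂ (ℓ₁ ⊔ t ⊔ r))
         (frame : TimeFrame t r) where

  open CompleteOrthomodularLattice L
  open TimeFrame frame
  open Tense L frame
  open Residuation orthomodularLattice

  Monotone : (Lᵀ → Lᵀ) → Set _
  Monotone A = ∀ {x y} → x ≤ᵀ y → A x ≤ᵀ A y

  -- Here and for `F`, `H`, `G`, the times `u` involved are the same for `x` and `y`, so values are
  -- compared at one and the same `u`. If there is no such `u`, the bound is vacuous.
  P-monotone : Monotone P
  P-monotone {x} {y} x≤y s =
    proj₂ (⋁-isSupremum (pastValues x s)) (P y s) λ a (u , uRs , a≈xu) →
      trans (reflexive a≈xu) (trans (x≤y u)
        (proj₁ (⋁-isSupremum (pastValues y s)) (y u) (u , uRs , Eq.refl)))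

  F-monotone : Monotone F
  F-monotone {x} {y} x≤y s =
    proj₂ (⋁-isSupremum (futureValues x s)) (F y s) λ a (u , sRu , a≈xu) →
      trans (reflexive a≈xu) (trans (x≤y u)
        (proj₁ (⋁-isSupremum (futureValues y s)) (y u) (u , sRu , Eq.refl)))

  H-monotone : Monotone H
  H-monotone {x} {y} x≤y s =
    proj₂ (⋀-isInfimum (pastValues y s)) (H x s) λ a (u , uRs , a≈yu) →
      trans (proj₁ (⋀-isInfimum (pastValues x s)) (x u) (u , uRs , Eq.refl))
        (trans (x≤y u) (reflexive (Eq.sym a≈yu)))

  G-monotone : Monotone G
  G-monotone {x} {y} x≤y s =
    proj₂ (⋀-isInfimum (futureValues y s)) (G x s) λ a (u , sRu , a≈yu) →
      trans (proj₁ (⋀-isInfimum (futureValues x s)) (x u) (u , sRu , Eq.refl))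
        (trans (x≤y u) (reflexive (Eq.sym a≈yu)))

  -- Merges the four cases: from here on `A` enters through its monotonicity.
  tense-monotone : ∀ {A} → A ∈ (P ∷ F ∷ H ∷ G ∷ []) → Monotone A
  tense-monotone (here refl)                         = P-monotone
  tense-monotone (there (here refl))                 = F-monotone
  tense-monotone (there (there (here refl)))         = H-monotone
  tense-monotone (there (there (there (here refl)))) = G-monotone

  monotone⇒⊙-lax⇔⇒-lax : ∀ {A} → Monotone A →
    (∀ x y → A x ⊙ᵀ A y ≤ᵀ A (x ⊙ᵀ y)) ⇔ (∀ x y → A (x ⇒ᵀ y) ≤ᵀ A x ⇒ᵀ A y)
  monotone⇒⊙-lax⇔⇒-lax {A} A-mono = mk⇔
    -- Taking the pair `x ⇒ᵀ y`, `x` lets the counit, under `A`, bound the right side by `A y`.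
    (λ ⊙-lax x y s → ⊙-residualʳ
      (trans (⊙-lax (x ⇒ᵀ y) x s) (A-mono (λ u → [x⇒y]⊙x≤y (x u) (y u)) s)))
    -- Taking the pair `y`, `x ⊙ᵀ y` makes the left side `A (y ⇒ᵀ (x ⊙ᵀ y))`, which is above `A x`
    -- by the unit.
    (λ ⇒-lax x y s → ⊙-residualˡ
      (trans (A-mono (λ u → x≤y⇒[x⊙y] (x u) (y u)) s) (⇒-lax y (x ⊙ᵀ y) s)))

theorem4p3 : {c ℓ₁ ℓ₂ t r : Level}
    (L : CompleteOrthomodularLattice c ℓ₁ ℓ₂ (ℓ₁ ⊔ t ⊔ r)) →
    CompleteOrthomodularLattice.NonTrivial L →
    (frame : TimeFrame t r) →
    let open Tense L frame in
    (A : Lᵀ → Lᵀ) → A ∈ (P ∷ F ∷ H ∷ G ∷ []) →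
    (∀ x y → A x ⊙ᵀ A y ≤ᵀ A (x ⊙ᵀ y)) ⇔ (∀ x y → A (x ⇒ᵀ y) ≤ᵀ A x ⇒ᵀ A y)
theorem4p3 L _ frame A A∈PFHG = monotone⇒⊙-lax⇔⇒-lax (tense-monotone A∈PFHG)
  where open TenseProperties L frame
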